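{- Let $\Upsilon$ be a finite set of directions and let $\mathcal{D}=\langle \Psi,\Sigma,Q,\eta,q_0,L\rangle$ be a deterministic finite transducer. Then the language of $\mathcal{D}$ is coverable by an $\Upsilon$-tree (that is, there is a $\Sigma$-labeled full $\Upsilon$-tree $T=\langle \Upsilon^*,\tau\rangle$ with $L(\mathcal{D})\subseteq L(T)$) if and only if there is a weight distribution $w$ for $\mathcal{D}$ and branching $\Upsilon$.
   Context: A finite transducer is $\mathcal{D}=\langle \Psi,\Sigma,Q,\eta,q_0,L\rangle$, where $\Psi$ is a finite set of directions, $\Sigma$ a finite alphabet, $Q$ a finite set of states, $\eta:Q\times\Psi\to Q$ a partial transition function, $q_0\in Q$ the start state and $L:Q\to\Sigma$ a labeling function. Extend $\eta$ to a partial function $\Psi^*\to Q$ by $\eta(\varepsilon)=q_0$, $\eta(x\psi)=\eta(\eta(x),\psi)$, and extend $L$ to a partial function $\Psi^*\to\Sigma^+$ by $L(\varepsilon)=L(q_0)$ and $L(x\psi)=L(x)\cdot L(\eta(x\psi))$. The language is $L(\mathcal{D})=\{L(x)\mid x\in\Psi^*,\ L(x)\text{ defined}\}$. The transducer is deterministic if for every $q\in Q$ and every $\psi_1,\psi_2\in\Psi$ (with $\eta(q,\psi_1),\eta(q,\psi_2)$ defined), $L(\eta(q,\psi_1))=L(\eta(q,\psi_2))$ implies $\eta(q,\psi_1)=\eta(q,\psi_2)$; that is, for every state $q$ and letter $\sigma\in\Sigma$ there is at most one successor of $q$ labeled by $\sigma$. We write $(q,\psi,q')\in\eta$ for $q'=\eta(q,\psi)$.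 A $\Sigma$-labeled full $\Upsilon$-tree is a pair $T=\langle\Upsilon^*,\tau\rangle$ with $\tau:\Upsilon^*\to\Sigma$. For $x\in\Upsilon^*$ let $x|_i$ be its prefix of length $i$, and let $\vec{\tau}(x)=\tau(x|_0)\tau(x|_1)\cdots\tau(x|_{|x|})$. Put $L(T)=\{\vec{\tau}(x)\mid x\in\Upsilon^*\}$. A weight distribution for $\mathcal{D}$ and branching $\Upsilon$ is a function $w:Q\cup(Q\times\Psi\times Q)\to\mathbb{N}$ such that: (1) $w(q_0)=1$; (2) for every $q\in Q$, $|\Upsilon|\cdot w(q)\ge\sum_{(q,\psi,q')\in\eta}w(q,\psi,q')$; (3) for every $(q,\psi,q')\in\eta$, $w(q,\psi,q')\ge w(q')$ and $w(q,\psi,q')>0$.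
   Formalization: "Only if" is stated for transducers with all states reachable and no two directions leading from a state to the same successor; otherwise it fails (one state, two loops, |Υ|=1: coverable, but (2),(3) give 1 ≥ 2; unreachable states can also break it). "If" has no extra condition. -}

module Defs where

open import Data.Fin.Base using (Fin)
open import Data.List.Base using (List; []; _∷_; [_]; _∷ʳ_; map; foldl; inits)
open import Data.List.Effectful using (module TraversableA)
open import Data.List.Properties using (foldl-∷ʳ; map-++)
open import Data.Maybe.Base as Maybe using (Maybe; just; nothing; maybe; _>>=_)
import Data.Maybe.Effectful as MaybeE
open import Data.Nat.Base using (ℕ; _*_; _≥_; _>_)
open import Data.Nat.Properties using (+-0-commutativeMonoid)
open import Data.Product.Base using (_×_; _,_; ∃-syntax)
open import Data.Sum.Base using (_⊎_; inj₁; inj₂)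
open import Level using (0ℓ)
open import Relation.Binary.PropositionalEquality using (_≡_; refl; sym; trans; cong)
open import Relation.Unary using (Pred; _⊆_)

open import Algebra.Properties.CommutativeMonoid.Sum +-0-commutativeMonoid using (sum-syntax)
open TraversableA {f = 0ℓ} MaybeE.applicative using (mapA)

-- d directions (Ψ = Fin d), s letters (Σ = Fin s), n states (Q = Fin n).
record Transducer (d s n : ℕ) : Set where
  field
    η  : Fin n → Fin d → Maybe (Fin n)
    q₀ : Fin n
    L  : Fin n → Fin s

  η* : List (Fin d) → Maybe (Fin n)
  η* = foldl (λ m ψ → m >>= λ q → η q ψ) (just q₀)

  -- The labels of the states reached by the prefixes of x, shortest prefix
  -- first; nothing as soon as one of these states is undefined.
  L* : List (Fin d) → Maybe (List (Fin s))
  L* x = mapA (λ y → Maybe.map L (η* y)) (inits x)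

  Language : Pred (List (Fin s)) 0ℓ
  Language u = ∃[ x ] L* x ≡ just u

  Deterministic : Set
  Deterministic = ∀ q ψ₁ ψ₂ {q₁ q₂} → η q ψ₁ ≡ just q₁ → η q ψ₂ ≡ just q₂ →
                  L q₁ ≡ L q₂ → q₁ ≡ q₂

  -- Every deterministic transducer has the same language as one satisfying the
  -- next two conditions, but the existence of a weight distribution depends on
  -- them.

  -- A state that is not reachable can rule out every weight distribution:
  -- if |Υ| = 1 and q has edges to itself and to some q′ ≠ q, the constraints
  -- at q force w(q) ≥ w(q) + 1.
  Accessible : Set
  Accessible = ∀ q → ∃[ x ] η* x ≡ just q

  -- Parallel edges are counted separately by the sum over (q, ψ, q′) ∈ η
  -- although they contribute the same words: if |Υ| = 1, a single state with
  -- two loops has no weight distribution, but its language is coverable.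
  -- Deterministic alone does not exclude them.
  NoParallelEdges : Set
  NoParallelEdges = ∀ q ψ₁ ψ₂ {q′} → η q ψ₁ ≡ just q′ → η q ψ₂ ≡ just q′ → ψ₁ ≡ ψ₂

-- Labellings of the full tree with k directions (Υ = Fin k).
Tree : ℕ → ℕ → Set
Tree k s = List (Fin k) → Fin s

pathLabels : ∀ {k s} → Tree k s → List (Fin k) → List (Fin s)
pathLabels τ x = map τ (inits x)

TreeLanguage : ∀ {k s} → Tree k s → Pred (List (Fin s)) 0ℓ
TreeLanguage τ u = ∃[ x ] pathLabels τ x ≡ u

module _ {d s n : ℕ} (k : ℕ) (D : Transducer d s n) where
  open Transducer D

  Coverable : Set
  Coverable = ∃[ τ ] Language ⊆ TreeLanguage {k} τ

  record IsWeightDistribution (w : Fin n ⊎ (Fin n × Fin d × Fin n) → ℕ) : Set where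
    field
      initial  : w (inj₁ q₀) ≡ 1
      -- As η is a partial function, each ψ contributes at most one edge.
      outgoing : ∀ q → k * w (inj₁ q) ≥
                 ∑[ ψ < d ] maybe (λ q′ → w (inj₂ (q , ψ , q′))) 0 (η q ψ)
      incoming : ∀ q ψ q′ → η q ψ ≡ just q′ →
                 w (inj₂ (q , ψ , q′)) ≥ w (inj₁ q′) × w (inj₂ (q , ψ , q′)) > 0

  HasWeightDistribution : Set
  HasWeightDistribution = ∃[ w ] IsWeightDistribution w

private
  inits-∷ʳ : ∀ {A : Set} (xs : List A) a → inits (xs ∷ʳ a) ≡ inits xs ∷ʳ (xs ∷ʳ a)
  inits-∷ʳ []       a = refl
  inits-∷ʳ (x ∷ xs) a = cong ([] ∷_)
    (trans (cong (map (x ∷_)) (inits-∷ʳ xs a)) (map-++ (x ∷_) (inits xs) _))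

  mapA-∷ʳ : ∀ {A B : Set} (f : A → Maybe B) xs a →
            mapA f (xs ∷ʳ a) ≡ (mapA f xs >>= λ us → Maybe.map (us ∷ʳ_) (f a))
  mapA-∷ʳ f [] a with f a
  ... | nothing = refl
  ... | just _  = refl
  mapA-∷ʳ f (x ∷ xs) a with f x
  ... | nothing = refl
  ... | just _ rewrite mapA-∷ʳ f xs a with mapA f xs | f a
  ...   | nothing | _       = refl
  ...   | just _  | nothing = refl
  ...   | just _  | just _  = refl

-- η* and L* satisfy the usual recursive equations on words extended at the end.
module _ {d s n : ℕ} (D : Transducer d s n) where
  open Transducer D

  η*-[] : η* [] ≡ just q₀
  η*-[] = refl

  η*-∷ʳ : ∀ x ψ → η* (x ∷ʳ ψ) ≡ (η* x >>= λ q → η q ψ)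
  η*-∷ʳ x ψ = foldl-∷ʳ _ (just q₀) ψ x

  L*-[] : L* [] ≡ just [ L q₀ ]
  L*-[] = refl

  L*-∷ʳ : ∀ x ψ → L* (x ∷ʳ ψ) ≡ (L* x >>= λ u → Maybe.map (λ q → u ∷ʳ L q) (η* (x ∷ʳ ψ)))
  L*-∷ʳ x ψ = trans (cong (mapA label) (inits-∷ʳ x ψ))
             (trans (mapA-∷ʳ label (inits x) (x ∷ʳ ψ)) (lemma (L* x) (η* (x ∷ʳ ψ))))
    where
    label : List (Fin d) → Maybe (Fin s)
    label y = Maybe.map L (η* y)

    lemma : ∀ (mu : Maybe (List (Fin s))) (mq : Maybe (Fin n)) →
            (mu >>= λ u → Maybe.map (u ∷ʳ_) (Maybe.map L mq)) ≡
            (mu >>= λ u → Maybe.map (λ q → u ∷ʳ L q) mq)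
    lemma nothing  _        = refl
    lemma (just _) nothing  = refl
    lemma (just _) (just _) = refl

{-# OPTIONS --safe #-}
module Submission where

-- From weights to trees: reserve at least max(1, w(q)) tree nodes for every word
-- leading to q. Their k · w(q) children can be shared out among the edges of q, and
-- an edge to q′ receives w(q, ψ, q′) ≥ max(1, w(q′)) of them.
-- From trees to weights: for a word u leading to q, the m(u) nodes labelled by u have
-- k · m(u) children, and by determinism these bound the sum of m(u σ) over the edges
-- of q. Choosing words u_q with m(u_q′) ≤ m(u_q L(q′)) along every edge makes
-- w(q) = m(u_q), w(q, ψ, q′) = m(u_q L(q′)) a weight distribution.

open import Defs
open import Data.Nat.Base using (ℕ)
open import Data.Product.Base using (_×_)

open import Algebra.Properties.CommutativeMonoid.Sum using (sum-syntax; ∑-distrib-+; sum-cong-≗; sum-replicate-zero)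
open import Data.Fin.Base using (Fin; zero; suc; toℕ; fromℕ<; combine; remQuot)
open import Data.Fin.Properties using (_≟_; any?; toℕ<n; toℕ-fromℕ<; toℕ-combine; combine-remQuot; suc-injective)
open import Data.List.Base using (List; []; _∷_; [_]; _∷ʳ_; map; foldl; inits; length; filter; allFin; cartesianProductWith)
open import Data.List.Membership.Propositional using (_∈_)
open import Data.List.Membership.Propositional.Properties using (∈-filter⁺; ∈-allFin; ∈-length; ∈-cartesianProductWith⁺)
open import Data.List.Properties using (foldl-∷ʳ; map-++; ∷ʳ-injective; ∷ʳ-injectiveˡ; length-++; length-map; length-tabulate)
open import Data.List.Relation.Unary.Any using (here)
open import Data.List.Reverse using (Reverse; []; _∶_∶ʳ_; reverseView)
open import Data.Maybe.Base as Maybe using (Maybe; just; nothing; maybe; _>>=_)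
open import Data.Maybe.Properties using (≡-dec; just-injective)
open import Data.Nat.Base using (zero; suc; _+_; _*_; _∸_; _⊔_; _≤_; _<_; z≤n; s≤s)
open import Data.Nat.Induction using (<-wellFounded)
open import Data.Nat.Properties hiding (_≟_; suc-injective)
open import Data.Product.Base as Product using (_,_; ∃-syntax; proj₁; proj₂)
open import Data.Sum.Base using (_⊎_; inj₁; inj₂)
open import Function.Base using (_∘_; id)
open import Induction.WellFounded using (Acc; acc)
open import Level using (0ℓ)
open import Relation.Binary.PropositionalEquality using (_≡_; _≢_; refl; sym; trans; cong; cong₂; subst)
open import Relation.Nullary using (Dec; yes; no; contradiction; _×-dec_)
open import Relation.Unary using (Pred; Decidable; _⊆_)

-- Finite sums, and positions in consecutive blocks.

∑ : ∀ {n} → (Fin n → ℕ) → ℕ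
∑ f = sum-syntax +-0-commutativeMonoid _ f

∑-mono-≤ : ∀ {n} {f g : Fin n → ℕ} → (∀ i → f i ≤ g i) → ∑ f ≤ ∑ g
∑-mono-≤ {zero}  f≤g = z≤n
∑-mono-≤ {suc n} f≤g = +-mono-≤ (f≤g zero) (∑-mono-≤ (f≤g ∘ suc))

∑-mono-< : ∀ {n} {f g : Fin n → ℕ} → (∀ i → f i ≤ g i) → ∀ i → f i < g i → ∑ f < ∑ g
∑-mono-< f≤g zero    f<g = +-mono-<-≤ f<g (∑-mono-≤ (f≤g ∘ suc))
∑-mono-< f≤g (suc i) f<g = +-mono-≤-< (f≤g zero) (∑-mono-< (f≤g ∘ suc) i f<g)

∑-zero : ∀ {n} {f : Fin n → ℕ} → (∀ i → f i ≡ 0) → ∑ f ≡ 0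
∑-zero {n} f≡0 = trans (sum-cong-≗ +-0-commutativeMonoid f≡0)
                       (sum-replicate-zero +-0-commutativeMonoid n)

-- Consecutive blocks of sizes `g i` fill the numbers below `∑ g`; the result is the block
-- containing `c` and the offset in it, `nothing` past the end.
block : ∀ {m} → (Fin m → ℕ) → ℕ → Maybe (Fin m × ℕ)
block {zero}  g c = nothing
block {suc m} g c with c <? g zero
... | yes _ = just (zero , c)
... | no  _ = Maybe.map (Product.map₁ suc) (block (g ∘ suc) (c ∸ g zero))

block-surjective : ∀ {m} (g : Fin m → ℕ) i {j} → j < g i →
                   ∃[ c ] c < ∑ g × block g c ≡ just (i , j)
block-surjective g zero {j} j<g = j , ≤-trans j<g (m≤m+n _ _) , found
  where
  found : block g j ≡ just (zero , j)
  found with j <? g zero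
  ... | yes _  = refl
  ... | no j≮g = contradiction j<g j≮g
block-surjective g (suc i) {j} j<g with block-surjective (g ∘ suc) i j<g
... | c , c<∑ , eq = g zero + c , +-monoʳ-< (g zero) c<∑ , found
  where
  found : block g (g zero + c) ≡ just (suc i , j)
  found with g zero + c <? g zero
  ... | yes below = contradiction below (m+n≮m (g zero) c)
  ... | no _ rewrite m+n∸m≡n (g zero) c | eq = refl

-- Division with remainder by `k`; going through `remQuot` spares a case split on `k = 0`.
divide : ∀ m k {c} → c < m * k → ∃[ j ] j < m × ∃[ i ] k * j + toℕ {k} i ≡ c
divide m k c<mk = toℕ j , toℕ<n j , i , trans (sym (toℕ-combine j i))
    (trans (cong toℕ (combine-remQuot {m} k (fromℕ< c<mk))) (toℕ-fromℕ< c<mk))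
  where
  j : Fin m
  j = proj₁ (remQuot {m} k (fromℕ< c<mk))
  i : Fin k
  i = proj₂ (remQuot {m} k (fromℕ< c<mk))

length-cartesianProductWith : ∀ {A B C : Set} (f : A → B → C) xs ys →
  length (cartesianProductWith f xs ys) ≡ length xs * length ys
length-cartesianProductWith f []       ys = refl
length-cartesianProductWith f (x ∷ xs) ys = trans (length-++ (map (f x) ys))
  (cong₂ _+_ (length-map (f x) ys) (length-cartesianProductWith f xs ys))

inits-∷ʳ : ∀ {A : Set} (xs : List A) a → inits (xs ∷ʳ a) ≡ inits xs ∷ʳ (xs ∷ʳ a)
inits-∷ʳ []       a = refl
inits-∷ʳ (x ∷ xs) a = cong ([] ∷_)
  (trans (cong (map (x ∷_)) (inits-∷ʳ xs a)) (map-++ (x ∷_) (inits xs) _))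

pathLabels-∷ʳ : ∀ {k s} (τ : Tree k s) y i →
                pathLabels τ (y ∷ʳ i) ≡ pathLabels τ y ∷ʳ τ (y ∷ʳ i)
pathLabels-∷ʳ τ y i = trans (cong (map τ) (inits-∷ʳ y i)) (map-++ τ (inits y) _)

module _ {A B : Set} where

  >>=-just : ∀ (m : Maybe A) {f : A → Maybe B} {b} → (m >>= f) ≡ just b →
             ∃[ a ] m ≡ just a × f a ≡ just b
  >>=-just (just a) eq = a , refl , eq

  map-just : ∀ (m : Maybe A) {f : A → B} {b} → Maybe.map f m ≡ just b → ∃[ a ] m ≡ just a
  map-just (just a) _ = a , refl

-- Counting through disjoint filters.

module _ {A B : Set} {P : A → Pred B 0ℓ} (P? : ∀ a → Decidable (P a)) where

  indicator : ∀ {b} a → Dec (P a b) → ℕ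
  indicator a (yes _) = 1
  indicator a (no  _) = 0

  ∑-indicator≤1 : ∀ {m} (f : Fin m → Maybe A) b →
    (∀ i j {a a′} → f i ≡ just a → f j ≡ just a′ → P a b → P a′ b → i ≡ j) →
    ∑ (λ i → maybe (λ a → indicator a (P? a b)) 0 (f i)) ≤ 1
  ∑-indicator≤1 {zero}  f b unique = z≤n
  ∑-indicator≤1 {suc m} f b unique with f zero in eq
  ... | nothing = ∑-indicator≤1 (f ∘ suc) b
        (λ i j p q u v → suc-injective (unique (suc i) (suc j) p q u v))
  ... | just a with P? a b
  ...   | no _ = ∑-indicator≤1 (f ∘ suc) b
          (λ i j p q u v → suc-injective (unique (suc i) (suc j) p q u v))
  -- By uniqueness no later index can contribute.
  ...   | yes Pab = ≤-reflexive (cong suc (∑-zero absent))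
    where
    absent : ∀ i → maybe (λ a → indicator a (P? a b)) 0 (f (suc i)) ≡ 0
    absent i with f (suc i) in eq′
    ... | nothing = refl
    ... | just a′ with P? a′ b
    ...   | no _ = refl
    ...   | yes Pa′b with () ← unique zero (suc i) eq eq′ Pab Pa′b

  -- Double counting: by uniqueness each `b` passes at most one of the filters.
  ∑-length-filter≤ : ∀ {m} (f : Fin m → Maybe A) →
    (∀ b i j {a a′} → f i ≡ just a → f j ≡ just a′ → P a b → P a′ b → i ≡ j) →
    ∀ bs → ∑ (λ i → maybe (λ a → length (filter (P? a) bs)) 0 (f i)) ≤ length bs
  ∑-length-filter≤ f unique [] = ≤-reflexive (∑-zero empty)
    where
    empty : ∀ i → maybe (λ a → length (filter (P? a) [])) 0 (f i) ≡ 0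
    empty i with f i
    ... | nothing = refl
    ... | just _  = refl
  ∑-length-filter≤ {m} f unique (b ∷ bs) = begin
    ∑ (count (b ∷ bs))       ≡⟨ sum-cong-≗ +-0-commutativeMonoid split ⟩
    ∑ (λ i → ind i + count bs i)
                             ≡⟨ ∑-distrib-+ +-0-commutativeMonoid ind (count bs) ⟩
    ∑ ind + ∑ (count bs)     ≤⟨ +-mono-≤ (∑-indicator≤1 f b (unique b)) (∑-length-filter≤ f unique bs) ⟩
    suc (length bs)          ∎
    where
    open ≤-Reasoning
    count : List B → Fin m → ℕ
    count bs i = maybe (λ a → length (filter (P? a) bs)) 0 (f i)
    ind : Fin m → ℕ
    ind i = maybe (λ a → indicator a (P? a b)) 0 (f i)
    split : ∀ i → count (b ∷ bs) i ≡ ind i + count bs i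
    split i with f i
    ... | nothing = refl
    ... | just a with P? a b
    ...   | yes _ = refl
    ...   | no  _ = refl

-- Runs of the transducer.

module _ {d s n : ℕ} (D : Transducer d s n) where
  open Transducer D

  -- Pairs a word with a path spelling it, grown at the end like the paths of the tree; both
  -- directions of the proof recurse on it.
  data Run : List (Fin s) → Fin n → Set where
    start : Run [ L q₀ ] q₀
    step  : ∀ {u q ψ q′} → Run u q → η q ψ ≡ just q′ → Run (u ∷ʳ L q′) q′

  run-nonempty : ∀ {u q} → Run u q → u ≢ []
  run-nonempty (step {[]} _ _) ()
  run-nonempty (step {_ ∷ _} _ _) ()

  step-word : ∀ x {u q} ψ {q′} → η* x ≡ just q → L* x ≡ just u → η q ψ ≡ just q′ →
              η* (x ∷ʳ ψ) ≡ just q′ × L* (x ∷ʳ ψ) ≡ just (u ∷ʳ L q′)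
  step-word x ψ {q′} ηx Lx e = ηxψ ,
    trans (L*-∷ʳ D x ψ)
      (cong₂ (λ mu mq → mu >>= λ u → Maybe.map (λ q → u ∷ʳ L q) mq) Lx ηxψ)
    where
    ηxψ : η* (x ∷ʳ ψ) ≡ just q′
    ηxψ = trans (η*-∷ʳ D x ψ) (trans (cong (_>>= λ q → η q ψ) ηx) e)

  run-word : ∀ {u q} → Run u q → ∃[ x ] η* x ≡ just q × L* x ≡ just u
  run-word start = [] , refl , refl
  run-word (step {ψ = ψ} r e) =
    let x , ηx , Lx = run-word r in x ∷ʳ ψ , step-word x ψ ηx Lx e

  -- If `η*` is defined on `x`, it is defined on all prefixes, so `L* x` is defined as well.
  η*-run : ∀ {x} → Reverse x → ∀ {q} → η* x ≡ just q → ∃[ u ] L* x ≡ just u × Run u q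
  η*-run [] refl = _ , refl , start
  η*-run (x ∶ x-rev ∶ʳ ψ) ηxψ =
    let _ , ηx , e = >>=-just (η* x) (trans (sym (η*-∷ʳ D x ψ)) ηxψ)
        _ , Lx , r = η*-run x-rev ηx
    in _ , proj₂ (step-word x ψ ηx Lx e) , step r e

  L*-run : ∀ {x} → Reverse x → ∀ {u} → L* x ≡ just u → ∃[ q ] Run u q
  L*-run [] refl = _ , start
  L*-run (x ∶ x-rev ∶ʳ ψ) Lxψ =
    let _ , _ , defined = >>=-just (L* x) (trans (sym (L*-∷ʳ D x ψ)) Lxψ)
        q , ηxψ         = map-just (η* (x ∷ʳ ψ)) defined
        _ , Lxψ′ , r    = η*-run (x ∶ x-rev ∶ʳ ψ) ηxψ
    in q , subst (λ u → Run u q) (just-injective (trans (sym Lxψ′) Lxψ)) r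

  -- From a weight distribution to a covering tree.

  module _ (k : ℕ) (w : Fin n ⊎ (Fin n × Fin d × Fin n) → ℕ)
           (isWeight : IsWeightDistribution k D w) where
    open IsWeightDistribution isWeight

    -- A missing edge gets an empty block, so `∑ (blockSize q)` is the sum in `outgoing`.
    blockSize : Fin n → Fin d → ℕ
    blockSize q ψ = maybe (λ q′ → w (inj₂ (q , ψ , q′))) 0 (η q ψ)

    -- An offset in the block of an edge becomes the copy number of its end state. The remaining
    -- cases only keep the tree full.
    target : Fin n → Maybe (Fin d × ℕ) → Fin n × ℕ
    target q nothing        = q , 0
    target q (just (ψ , j)) = maybe (_, j) (q , j) (η q ψ)

    -- The node carrying the copy number j of q has as children the numbers
    -- k j, …, k j + k - 1 of the children of all copies of q; these numbers are cut
    -- into blocks, one for each edge. Numbers past the last block are junk.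
    child : Fin n × ℕ → Fin k → Fin n × ℕ
    child (q , j) i = target q (block (blockSize q) (k * j + toℕ i))

    copy : List (Fin k) → Fin n × ℕ
    copy = foldl child (q₀ , 0)

    cover : Tree k s
    cover = L ∘ proj₁ ∘ copy

    -- A state of weight 0 needs a copy as well.
    cover-run : ∀ {u q} → Run u q → ∀ {j} → j < w (inj₁ q) ⊔ 1 →
                ∃[ y ] copy y ≡ (q , j) × pathLabels cover y ≡ u
    -- As w(q₀) = 1, the only copy to place is number 0, at the root.
    cover-run start j< rewrite initial with s≤s z≤n ← j< = [] , refl , refl
    cover-run (step {u} {q} {ψ} {q′} r e) {j} j<
      with c , c<∑ , at-c ← block-surjective (blockSize q) ψ {j}
             (subst (j <_) (sym (cong (maybe (λ q′ → w (inj₂ (q , ψ , q′))) 0) e))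
               (≤-trans j< (⊔-lub (proj₁ (incoming q ψ q′ e)) (proj₂ (incoming q ψ q′ e)))))
      -- By `outgoing`, `c` is below k · w(q): its quotient by k is the copy number of the parent,
      -- its remainder the direction.
      with j′ , j′< , i , refl ← divide (w (inj₁ q)) k
             (≤-trans c<∑ (≤-trans (outgoing q) (≤-reflexive (*-comm k (w (inj₁ q))))))
      with y , copy-y , labels ← cover-run r (≤-trans j′< (m≤m⊔n _ 1))
      = y ∷ʳ i , copy-y∷ʳi
      , trans (pathLabels-∷ʳ cover y i) (cong₂ _∷ʳ_ labels (cong (L ∘ proj₁) copy-y∷ʳi))
      where
      copy-y∷ʳi : copy (y ∷ʳ i) ≡ (q′ , j)
      copy-y∷ʳi rewrite foldl-∷ʳ child (q₀ , 0) i y | copy-y | at-c | e = refl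

    coverable : Coverable k D
    coverable = cover , λ (x , Lx) →
      let q , r = L*-run (reverseView x) Lx
          y , _ , labels = cover-run r (m≤n⊔m (w (inj₁ q)) 1)
      in y , labels

  -- From a covering tree to a weight distribution.

  module _ (k : ℕ) (det : Deterministic) (noParallel : NoParallelEdges)
           (τ : Tree k s) (covers : Language ⊆ TreeLanguage τ) where

    children : List (List (Fin k)) → List (List (Fin k))
    children ys = cartesianProductWith _∷ʳ_ ys (allFin k)

    extend : List (List (Fin k)) → Fin n → List (List (Fin k))
    extend ys q = filter (λ y → L q ≟ τ y) (children ys)

    -- Finds the nodes counted by m(u) level by level along the run. At `start` the root is listed
    -- without a test of its label, so the length there is 1 by definition.
    nodes : ∀ {u q} → Run u q → List (List (Fin k))
    nodes start              = [ [] ]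
    nodes (step {q′ = q} r _) = extend (nodes r) q

    -- The last letter and the last direction are peeled off together; a mismatch in length ends in
    -- an empty word that cannot be empty.
    nodes-complete : ∀ {u q} (r : Run u q) y → pathLabels τ y ≡ u → y ∈ nodes r
    nodes-complete r y = go r (reverseView y)
      where
      go : ∀ {u q} (r : Run u q) {y} → Reverse y → pathLabels τ y ≡ u → y ∈ nodes r
      go start        []               _  = here refl
      go start        (y ∶ y-rev ∶ʳ i) eq =
        contradiction (∷ʳ-injectiveˡ _ [] (trans (sym (pathLabels-∷ʳ τ y i)) eq))
                      (pathLabels≢[] y)
        where
        pathLabels≢[] : ∀ y → pathLabels τ y ≢ []
        pathLabels≢[] y ()
      go (step {u} r e) []             eq =
        contradiction (sym (∷ʳ-injectiveˡ [] u eq)) (run-nonempty r)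
      go (step {u} r e) (y ∶ y-rev ∶ʳ i) eq
        with labels , label ← ∷ʳ-injective _ u (trans (sym (pathLabels-∷ʳ τ y i)) eq)
        = ∈-filter⁺ _ (∈-cartesianProductWith⁺ _∷ʳ_ (go r y-rev labels) (∈-allFin i)) (sym label)

    size : ∀ {u q} → Run u q → ℕ
    size = length ∘ nodes

    -- Coverage enters here: the word of a run is in the language, so some node spells it.
    size>0 : ∀ {u q} (r : Run u q) → 0 < size r
    size>0 r with x , _ , Lx ← run-word r with y , labels ← covers (x , Lx)
      = ∈-length (nodes-complete r y labels)

    ∑-extend≤ : ∀ {u q} (r : Run u q) →
      ∑ (λ ψ → maybe (length ∘ extend (nodes r)) 0 (η q ψ)) ≤ k * size r
    ∑-extend≤ {q = q} r = begin
      ∑ (λ ψ → maybe (length ∘ extend (nodes r)) 0 (η q ψ))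
        ≤⟨ ∑-length-filter≤ (λ q y → L q ≟ τ y) (η q) unique (children (nodes r)) ⟩
      length (children (nodes r))
        ≡⟨ length-cartesianProductWith _∷ʳ_ (nodes r) (allFin k) ⟩
      size r * length (allFin k) ≡⟨ cong (size r *_) (length-tabulate {n = k} id) ⟩
      size r * k                 ≡⟨ *-comm (size r) k ⟩
      k * size r                 ∎
      where
      open ≤-Reasoning
      unique : ∀ y ψ ψ′ {q₁ q₂} → η q ψ ≡ just q₁ → η q ψ′ ≡ just q₂ →
               L q₁ ≡ τ y → L q₂ ≡ τ y → ψ ≡ ψ′
      -- Equal labels force equal targets by determinism, and `noParallel` then identifies the
      -- directions.
      unique y ψ ψ′ e e′ l l′ with refl ← det q ψ ψ′ e e′ (trans l (sym l′)) = noParallel q ψ ψ′ e e′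

    Choice : Set
    Choice = ∀ q → ∃[ u ] Run u q

    sizeAt : Choice → Fin n → ℕ
    sizeAt c q = size (proj₂ (c q))

    replace : Choice → ∀ {u q} → Run u q → Choice
    replace c {q = q} r q′ with q ≟ q′
    ... | yes refl = _ , r
    ... | no  _    = c q′

    replace-at : ∀ c {u q} (r : Run u q) → sizeAt (replace c r) q ≡ size r
    replace-at c {q = q} r with q ≟ q
    ... | yes refl = refl
    ... | no  q≢q  = contradiction refl q≢q

    replace-≤ : ∀ c {u q} (r : Run u q) → size r ≤ sizeAt c q →
                ∀ q′ → sizeAt (replace c r) q′ ≤ sizeAt c q′
    replace-≤ c {q = q} r r≤ q′ with q ≟ q′
    ... | yes refl = r≤
    ... | no  _    = ≤-refl

    -- The inequality w(q, ψ, q′) ≥ w(q′) for the weights read off from `c`.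
    Stable : Choice → Set
    Stable c = ∀ q ψ q′ (e : η q ψ ≡ just q′) → sizeAt c q′ ≤ size (step (proj₂ (c q)) e)

    -- The minimum of size over all runs to a state need not be computable, but
    -- replacing a run by a smaller one ending in an edge strictly decreases the total.
    stabilise : ∀ c → Acc _<_ (∑ (sizeAt c)) → sizeAt c q₀ ≤ 1 →
                ∃[ c ] Stable c × sizeAt c q₀ ≤ 1
    stabilise c (acc rec) c₀≤1
      -- The size of the extended run is written out, so that it can be tested without a proof of
      -- the edge.
      with any? (λ q → any? λ ψ → any? λ q′ → ≡-dec _≟_ (η q ψ) (just q′)
             ×-dec (length (extend (nodes (proj₂ (c q))) q′) <? sizeAt c q′))
    ... | no stable = c , (λ q ψ q′ e → ≮⇒≥ (λ lt → stable (q , ψ , q′ , e , lt))) , c₀≤1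
    ... | yes (q , ψ , q′ , e , lt) =
      let r   = step (proj₂ (c q)) e
          dec = replace-≤ c r (<⇒≤ lt)
      in stabilise (replace c r)
           (rec (∑-mono-< dec q′ (subst (_< sizeAt c q′) (sym (replace-at c r)) lt)))
           (≤-trans (dec q₀) c₀≤1)

    hasWeightDistribution : Accessible → HasWeightDistribution k D
    hasWeightDistribution accessible = w , record
      { initial  = ≤-antisym c₀≤1 (size>0 (run q₀))
      ; outgoing = ∑-extend≤ ∘ run
      ; incoming = λ q ψ q′ e → stable q ψ q′ e , size>0 (step (run q) e)
      }
      where
      reaching : Choice
      reaching q with x , ηx ← accessible q with u , _ , r ← η*-run (reverseView x) ηx = u , r

      stabilised : ∃[ c ] Stable c × sizeAt c q₀ ≤ 1
      -- Beginning with `start` at `q₀` gives size 1 there, and no replacement increases a size.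
      stabilised = stabilise (replace reaching start) (<-wellFounded _)
                     (≤-reflexive (replace-at reaching start))

      c₀≤1 : sizeAt (proj₁ stabilised) q₀ ≤ 1
      c₀≤1 = proj₂ (proj₂ stabilised)

      stable : Stable (proj₁ stabilised)
      stable = proj₁ (proj₂ stabilised)

      run : ∀ q → Run _ q
      run q = proj₂ (proj₁ stabilised q)

      w : Fin n ⊎ (Fin n × Fin d × Fin n) → ℕ
      w (inj₁ q)            = size (run q)
      -- On an edge `e` this is `size (step (run q) e)` by definition.
      w (inj₂ (q , _ , q′)) = length (extend (nodes (run q)) q′)

theorem2 : ∀ {d s n : ℕ} (k : ℕ) (D : Transducer d s n) → Transducer.Deterministic D →
    (HasWeightDistribution k D → Coverable k D) ×
    (Transducer.Accessible D → Transducer.NoParallelEdges D →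
    Coverable k D → HasWeightDistribution k D)
theorem2 k D det =
  (λ (w , isWeight) → coverable D k w isWeight) ,
  λ accessible noParallel (τ , covers) →
    hasWeightDistribution D k det noParallel τ covers accessible
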